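{- Let $N_A=[NA(n,k)]_{n,k\geq 0}$ be the infinite lower-triangular matrix with entries $NA(n,k)=\frac{1}{k+1}\binom{n+1}{k}\binom{n}{k}$ for $0\le k\le n$ and $NA(n,k)=0$ for $k>n$ (the Narayana triangle of type $A$), and let $N_B=[NB(n,k)]_{n,k\geq 0}$ be the infinite lower-triangular matrix with entries $NB(n,k)=\binom{n}{k}^2$ (which vanishes for $k>n$) (the Narayana triangle of type $B$). Then both $N_A$ and $N_B$ are totally positive.
   Context: A (finite or infinite) real matrix is totally positive (TP) if all of its minors are nonnegative. -}

module Defs where

open import Data.Nat as ℕ using (ℕ; zero; suc)
open import Data.Nat.Combinatorics using (_C_)
open import Data.Fin as Fin using (Fin; punchIn)
import Relation.Nullary
open import Data.Integer as ℤ using (ℤ; +_; -_)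

∑ : ∀ {n} → (Fin n → ℤ) → ℤ
∑ {zero}  f = + 0
∑ {suc n} f = f Fin.zero ℤ.+ ∑ (λ i → f (Fin.suc i))

sgn : ℕ → ℤ
sgn zero    = + 1
sgn (suc j) = - sgn j

det : ∀ {n} → (Fin n → Fin n → ℤ) → ℤ
det {zero}  M = + 1
det {suc n} M =
  ∑ (λ j → sgn (Fin.toℕ j) ℤ.* (M Fin.zero j ℤ.* det (λ i k → M (Fin.suc i) (punchIn j k))))

StrictlyIncreasing : ∀ {k} → (Fin k → ℕ) → Set
StrictlyIncreasing {k} r = ∀ (i j : Fin k) → i Fin.< j → r i ℕ.< r j

InfMatrix : Set
InfMatrix = ℕ → ℕ → ℤ

minor : (A : InfMatrix) → ∀ {k} → (Fin k → ℕ) → (Fin k → ℕ) → ℤ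
minor A r c = det (λ i j → A (r i) (c j))

TotallyPositive : InfMatrix → Set
TotallyPositive A =
  ∀ (k : ℕ) (r c : Fin k → ℕ) →
  StrictlyIncreasing r → StrictlyIncreasing c → + 0 ℤ.≤ minor A r c

-- Narayana numbers of type A: (1/(k+1)) C(n+1,k) C(n,k) for k ≤ n, 0 for k > n
-- (the division is exact)
NA : ℕ → ℕ → ℕ
NA n k with k ℕ.≤? n
... | Relation.Nullary.yes _ = ((suc n C k) ℕ.* (n C k)) ℕ./ suc k
... | Relation.Nullary.no _  = 0

NB : ℕ → ℕ → ℕ
NB n k = (n C k) ℕ.* (n C k)

NarayanaA : InfMatrix
NarayanaA n k = + NA n k

NarayanaB : InfMatrix
NarayanaB n k = + NB n k

{-# OPTIONS --safe #-}
module Submission where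

-- Up to row and column scaling, the two triangles are the lower triangular Toeplitz matrices of
-- f_a = Σ xⁿ / (n! (n+a)!) for a = 0 (type B) and a = 1 (type A). The contiguous relation
-- f_a = (a+1) f_{a+1} + x f_{a+2} says that the Hurwitz-type matrix which interleaves the rows of
-- the Toeplitz matrices of f_a and f_{a+1} is a nonnegative bidiagonal matrix times the one for
-- f_{a+1} and f_{a+2}, and multiplication by such a factor preserves total positivity. Iterating
-- never ends for f_a itself, so f_a is replaced by the polynomials p which satisfy the same
-- relation but stop after ν steps; their coefficients have a closed form. Suitably scaled, these
-- coefficients are polynomials in ν whose leading coefficients are the Narayana numbers, so each
-- minor of the triangles is the leading coefficient of a nonnegative polynomial.

open import Defs
open import Data.Empty using (⊥-elim)
open import Data.Fin as Fin using (Fin; punchIn; inject₁)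
import Data.Fin.Properties as Fin
open import Data.Integer as ℤ using (ℤ; -[1+_]; ∣_∣; +≤+)
import Data.Integer.Properties as ℤ
open import Data.Integer.Solver using (module +-*-Solver)
open import Data.Nat as ℕ using (ℕ; zero; suc; z≤n; s≤s; _!)
open import Data.Nat.Divisibility using (_∣_; 1∣_; ∣m+n∣m⇒∣n; m∣m*n)
open import Data.Nat.DivMod using (m/n*n≡m)
import Data.Nat.Properties as ℕ
open import Data.Nat.Tactic.RingSolver using (solve-∀)
open import Data.Product using (_×_; _,_; ∃)
open import Function using (_∘_)
open import Relation.Binary using (tri<; tri≈; tri>)
open import Relation.Binary.PropositionalEquality
open import Relation.Nullary using (yes; no)

module _ where
  open import Data.Nat using (_+_; _*_; _∸_)
  open import Data.Nat.Combinatorics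
    using (_C_; nCk≡n!/k![n-k]!; k![n∸k]!∣n!; k>n⇒nCk≡0; nCk+nC[k+1]≡[n+1]C[k+1])
  open ≡-Reasoning

  -- Truncated Bessel polynomials

  -- The entry is `f (i - 2k)`, and zero when `i < 2k`. The even rows thus form the Toeplitz matrix
  -- of the even-indexed part of `f`, the odd rows that of the odd-indexed part.
  hurwitz : (ℕ → ℕ) → ℕ → ℕ → ℕ
  hurwitz f i             zero    = f i
  hurwitz f zero          (suc k) = 0
  hurwitz f (suc zero)    (suc k) = 0
  hurwitz f (suc (suc i)) (suc k) = hurwitz f i k

  hurwitz-even : ∀ f k j → hurwitz f ((k + j) * 2) k ≡ f (j * 2)
  hurwitz-even f zero    j = refl
  hurwitz-even f (suc k) j = hurwitz-even f k j

  hurwitz-upper : ∀ f {n k} → n ℕ.< k → hurwitz f (n * 2) k ≡ 0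
  hurwitz-upper f {zero}  {suc k} _         = refl
  hurwitz-upper f {suc n} {suc k} (s≤s n<k) = hurwitz-upper f n<k

  -- Diagonal of the bidiagonal factor. Even rows carry the coefficient a + 1 of the contiguous
  -- relation; odd rows have 0, since they only copy the row above from the next matrix.
  weight : ℕ → ℕ → ℕ
  weight a zero          = suc a
  weight a (suc zero)    = 0
  weight a (suc (suc i)) = weight a i

  weight-even : ∀ a j → weight a (j * 2) ≡ suc a
  weight-even a zero    = refl
  weight-even a (suc j) = weight-even a j

  weight-odd : ∀ a j → weight a (suc (j * 2)) ≡ 0
  weight-odd a zero    = refl
  weight-odd a (suc j) = weight-odd a j

  -- With p(0,a) = 0, p(1,a) = 1 and p(ν+2,a) = (a+1) p(ν+1,a+1) + x p(ν,a+2), the even entries of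
  -- bessel ν a are the coefficients of p(ν+1,a), the odd ones those of p(ν,a+1).
  bessel : ℕ → ℕ → ℕ → ℕ
  bessel zero    a zero    = 1
  bessel zero    a (suc l) = 0
  bessel (suc ν) a zero    = weight a zero * bessel ν (suc a) zero
  bessel (suc ν) a (suc l) = weight a (suc l) * bessel ν (suc a) (suc l) + bessel ν (suc a) l

  -- Subdiagonal of the bidiagonal factor. It is 0 in row 0, where `ℕ.pred` would otherwise count
  -- row 0 a second time.
  below : ℕ → ℕ
  below zero    = 0
  below (suc i) = 1

  -- `weight a` has period 2, and moving one column to the right in `hurwitz` shifts the rows by 2.
  -- Hence the recursion for the sequence, which is column 0, repeats in every column and becomes a
  -- factorization of matrices.
  hurwitz-bessel : ∀ ν a i k → let H = hurwitz (bessel ν (suc a)) in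
    hurwitz (bessel (suc ν) a) i k ≡ weight a i * H i k + below i * H (ℕ.pred i) k
  hurwitz-bessel ν a zero    zero = sym (ℕ.+-identityʳ _)
  hurwitz-bessel ν a (suc i) zero =
    cong (weight a (suc i) * bessel ν (suc a) (suc i) +_) (sym (ℕ.*-identityˡ _))
  hurwitz-bessel ν a zero                (suc k) = sym (trans (ℕ.+-identityʳ _) (ℕ.*-zeroʳ (suc a)))
  hurwitz-bessel ν a (suc zero)          (suc k) = refl
  hurwitz-bessel ν a (suc (suc zero))    (suc k) = hurwitz-bessel ν a zero k
  hurwitz-bessel ν a (suc (suc (suc i))) (suc k) = hurwitz-bessel ν a (suc i) k

  hurwitz-support : ∀ a i k → hurwitz (bessel 0 a) i k ≢ 0 → i ≡ k * 2
  hurwitz-support a zero    zero    ≢0 = refl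
  hurwitz-support a (suc i) zero    ≢0 = ⊥-elim (≢0 refl)
  hurwitz-support a zero          (suc k) ≢0 = ⊥-elim (≢0 refl)
  hurwitz-support a (suc zero)    (suc k) ≢0 = ⊥-elim (≢0 refl)
  hurwitz-support a (suc (suc i)) (suc k) ≢0 = cong (suc ∘ suc) (hurwitz-support a i k ≢0)

  bessel-vanishes : ∀ {ν l} a → ν ℕ.< l → bessel ν a l ≡ 0
  bessel-vanishes {zero}  {suc l} a _         = refl
  bessel-vanishes {suc ν} {suc l} a (s≤s ν<l) = trans
    (cong₂ (λ x y → weight a (suc l) * x + y)
      (bessel-vanishes (suc a) (ℕ.m<n⇒m<1+n ν<l)) (bessel-vanishes (suc a) ν<l))
    (trans (ℕ.+-identityʳ _) (ℕ.*-zeroʳ (weight a (suc l))))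

  -- The contiguous relation, read off coefficientwise: two steps of the recursion, the odd weight
  -- in between being 0.
  bessel-even : ∀ ν a j → bessel (suc (suc ν)) a (suc j * 2)
    ≡ suc a * bessel (suc ν) (suc a) (suc j * 2) + bessel ν (suc (suc a)) (j * 2)
  bessel-even ν a j rewrite weight-even a j | weight-odd (suc a) j = refl

  -- The even entry 2j at level ν = 2j + i is (i+j)! (a+i+j)! / (i! j! (a+j)!). Induction along
  -- `bessel-even`: its first term lowers `i`, its second lowers `j`.
  bessel-closed : ∀ j i a →
    bessel (j * 2 + i) a (j * 2) * (i ! * (j ! * (a + j) !)) ≡ (i + j) ! * (a + i + j) !
  bessel-closed zero zero a = cong (1 *_) (trans (ℕ.*-identityˡ (1 * (a + 0) !))
    (trans (ℕ.*-identityˡ ((a + 0) !)) (cong _! (sym (ℕ.+-identityʳ (a + 0))))))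
  bessel-closed zero (suc i) a = begin
    suc a * b * (suc i * i ! * (1 * (a + 0) !))
      ≡⟨ cong (λ x → suc a * b * (suc i * i ! * (1 * x !))) (ℕ.+-identityʳ a) ⟩
    suc a * b * (suc i * i ! * (1 * a !))
      ≡⟨ shuffle (suc a) b (suc i) (i !) (a !) ⟩
    suc i * (b * (i ! * (1 * (suc a) !)))
      ≡⟨ cong (λ x → suc i * (b * (i ! * (1 * x !)))) (sym (ℕ.+-identityʳ (suc a))) ⟩
    suc i * (b * (i ! * (1 * (suc a + 0) !)))
      ≡⟨ cong (suc i *_) (bessel-closed zero i (suc a)) ⟩
    suc i * ((i + 0) ! * (suc a + i + 0) !)
      ≡⟨ cong₂ (λ x y → suc i * (x ! * y !)) (ℕ.+-identityʳ i)
           (cong (_+ 0) (sym (ℕ.+-suc a i))) ⟩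
    suc i * (i ! * (a + suc i + 0) !)
      ≡⟨ sym (ℕ.*-assoc (suc i) (i !) _) ⟩
    suc i * i ! * (a + suc i + 0) !
      ≡⟨ cong (λ x → x ! * (a + suc i + 0) !) (sym (ℕ.+-identityʳ (suc i))) ⟩
    (suc i + 0) ! * (a + suc i + 0) ! ∎
    where
    b = bessel i (suc a) 0
    shuffle : ∀ p b q x y → p * b * (q * x * (1 * y)) ≡ q * (b * (x * (1 * (p * y))))
    shuffle = solve-∀
  bessel-closed (suc j) zero a = begin
    bessel (suc j * 2 + 0) a (suc j * 2) * (1 * (suc j * j ! * (a + suc j) !))
      -- For i = 0 the first term of the contiguous relation vanishes: its index 2j + 2 exceeds its
      -- level 2j + 1.
      ≡⟨ cong (λ x → x * (1 * (suc j * j ! * (a + suc j) !))) (trans (bessel-even (j * 2 + 0) a j)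
           (cong (λ x → suc a * x + b) (bessel-vanishes (suc a)
              (subst (λ x → suc x ℕ.< suc j * 2) (sym (ℕ.+-identityʳ (j * 2))) ℕ.≤-refl)))) ⟩
    (suc a * 0 + b) * (1 * (suc j * j ! * (a + suc j) !))
      ≡⟨ shuffle (suc a) b (suc j) (j !) ((a + suc j) !) ⟩
    suc j * (b * (1 * (j ! * (a + suc j) !)))
      ≡⟨ ℕ.*-cancelˡ-≡ _ _ (suc (suc a + j)) (begin
           suc (suc a + j) * (suc j * (b * (1 * (j ! * (a + suc j) !))))
             ≡⟨ cong (λ x → suc (suc a + j) * (suc j * (b * (1 * (j ! * x !))))) (ℕ.+-suc a j) ⟩
           suc (suc a + j) * (suc j * (b * (1 * (j ! * (suc a + j) !))))
             ≡⟨ shuffle₂ (suc (suc a + j)) (suc j) b (j !) ((suc a + j) !) ⟩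
           suc j * (b * (1 * (j ! * (suc (suc a) + j) !)))
             ≡⟨ cong (suc j *_) (bessel-closed j zero (suc (suc a))) ⟩
           suc j * (j ! * (suc (suc a) + 0 + j) !)
             ≡⟨ cong (λ x → suc j * (j ! * (suc (suc x) + j) !)) (ℕ.+-identityʳ a) ⟩
           suc j * (j ! * (suc (suc a + j) * (suc a + j) !))
             ≡⟨ shuffle₃ (suc j) (j !) (suc (suc a + j)) ((suc a + j) !) ⟩
           suc (suc a + j) * (suc j * j ! * (suc a + j) !) ∎) ⟩
    suc j * j ! * (suc a + j) !
      ≡⟨ cong (λ x → suc j * j ! * x !) (trans (sym (ℕ.+-suc a j)) (cong (_+ suc j) (sym (ℕ.+-identityʳ a)))) ⟩
    suc j * j ! * (a + 0 + suc j) ! ∎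
    where
    b = bessel (j * 2 + 0) (suc (suc a)) (j * 2)
    shuffle : ∀ p b q x y → (p * 0 + b) * (1 * (q * x * y)) ≡ q * (b * (1 * (x * y)))
    shuffle = solve-∀
    shuffle₂ : ∀ p q b x y → p * (q * (b * (1 * (x * y)))) ≡ q * (b * (1 * (x * (p * y))))
    shuffle₂ = solve-∀
    shuffle₃ : ∀ q x p y → q * (x * (p * y)) ≡ p * (q * x * y)
    shuffle₃ = solve-∀
  -- The factor a + j + 2 turns (a+1+j)! into (a+2+j)!, the factorial that occurs in both induction
  -- hypotheses.
  bessel-closed (suc j) (suc i) a = ℕ.*-cancelˡ-≡ _ _ (suc (suc a + j)) (begin
    A₂ * (bessel (suc j * 2 + suc i) a (suc j * 2) * (suc i * i ! * (suc j * j ! * (a + suc j) !)))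
      ≡⟨ cong₂ (λ x y → A₂ * (x * (suc i * i ! * (suc j * j ! * y !))))
           (bessel-even (j * 2 + suc i) a j) (ℕ.+-suc a j) ⟩
    A₂ * ((suc a * b₁ + b₂) * (suc i * i ! * (suc j * j ! * X)))
      ≡⟨ shuffle A₂ (suc a) b₁ b₂ (suc i) (i !) (suc j) (j !) X ⟩
    suc a * suc i * (b₁ * (i ! * (suc j * j ! * (A₂ * X)))) + suc j * (b₂ * (suc i * i ! * (j ! * (A₂ * X))))
      ≡⟨ cong₂ (λ x y → suc a * suc i * x + suc j * y) first second ⟩
    suc a * suc i * (U * V) + suc j * (U * (suc (suc (a + i + suc j)) * V))
      -- Up to the common factor `U * V` this is (a+1)(i+1) + (j+1)(a+i+j+3) = (a+j+2)(i+j+2).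
      ≡⟨ finish a i j U V ⟩
    A₂ * (suc (i + suc j) * U * V)
      ≡⟨ cong (λ x → A₂ * (suc (i + suc j) * U * x !)) (cong (_+ suc j) (sym (ℕ.+-suc a i))) ⟩
    A₂ * ((suc i + suc j) ! * (a + suc i + suc j) !) ∎)
    where
    A₂ = suc (suc a + j)
    X = (suc a + j) !
    U = (i + suc j) !
    V = (suc a + i + suc j) !
    b₁ = bessel (suc (j * 2 + suc i)) (suc a) (suc j * 2)
    b₂ = bessel (j * 2 + suc i) (suc (suc a)) (j * 2)
    first : b₁ * (i ! * (suc j * j ! * (A₂ * X))) ≡ U * V
    first = begin
      b₁ * (i ! * (suc j * j ! * (A₂ * X)))
        ≡⟨ cong₂ (λ x y → bessel (suc x) (suc a) (suc j * 2) * (i ! * (suc j * j ! * y !)))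
             (ℕ.+-suc (j * 2) i) (sym (ℕ.+-suc (suc a) j)) ⟩
      bessel (suc j * 2 + i) (suc a) (suc j * 2) * (i ! * ((suc j) ! * (suc a + suc j) !))
        ≡⟨ bessel-closed (suc j) i (suc a) ⟩
      U * V ∎
    second : b₂ * (suc i * i ! * (j ! * (A₂ * X))) ≡ U * (suc (suc (a + i + suc j)) * V)
    second = trans (bessel-closed j (suc i) (suc (suc a)))
      (cong₂ (λ x y → x ! * y) (sym (ℕ.+-suc i j)) (cong (λ x → (suc (suc x)) !)
        (trans (cong (_+ j) (ℕ.+-suc a i)) (sym (ℕ.+-suc (a + i) j)))))
    shuffle : ∀ A p b₁ b₂ q x r y X →
      A * ((p * b₁ + b₂) * (q * x * (r * y * X)))
      ≡ p * q * (b₁ * (x * (r * y * (A * X)))) + r * (b₂ * (q * x * (y * (A * X))))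
    shuffle = solve-∀
    finish : ∀ a i j U V →
      suc a * suc i * (U * V) + suc j * (U * (suc (suc (a + i + suc j)) * V))
      ≡ suc (suc a + j) * (suc (i + suc j) * U * V)
    finish = solve-∀

  -- Narayana numbers as quotients of factorials

  -- The rising factorial (b+1)(b+2)...(b+l) = (b+l)! / b!, written as a product so that it is
  -- visibly a monic polynomial of degree `l` in `b`.
  rise : ℕ → ℕ → ℕ
  rise b zero    = 1
  rise b (suc l) = suc (b + l) * rise b l

  rise-! : ∀ b l → rise b l * b ! ≡ (b + l) !
  rise-! b zero    = trans (ℕ.*-identityˡ (b !)) (cong _! (sym (ℕ.+-identityʳ b)))
  rise-! b (suc l) = begin
    suc (b + l) * rise b l * b !   ≡⟨ ℕ.*-assoc (suc (b + l)) (rise b l) (b !) ⟩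
    suc (b + l) * (rise b l * b !) ≡⟨ cong (suc (b + l) *_) (rise-! b l) ⟩
    (suc (b + l)) !                ≡⟨ cong _! (sym (ℕ.+-suc b l)) ⟩
    (b + suc l) !                  ∎

  C-! : ∀ k j → ((k + j) C k) * (k ! * j !) ≡ (k + j) !
  C-! k j = begin
    ((k + j) C k) * (k ! * j !)
      ≡⟨ cong (λ x → ((k + j) C k) * (k ! * x !)) (sym (ℕ.m+n∸m≡n k j)) ⟩
    ((k + j) C k) * (k ! * (k + j ∸ k) !)
      ≡⟨ cong (_* (k ! * (k + j ∸ k) !)) (nCk≡n!/k![n-k]! (ℕ.m≤m+n k j)) ⟩
    ((k + j) ! ℕ./ (k ! * (k + j ∸ k) !)) * (k ! * (k + j ∸ k) !)
      ≡⟨ m/n*n≡m (k![n∸k]!∣n! (ℕ.m≤m+n k j)) ⟩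
    (k + j) ! ∎
    where instance
      _ = k ℕ.!* (k + j ∸ k) !≢0

  C-absorb : ∀ k j → suc k * ((k + j) C suc k) ≡ j * ((k + j) C k)
  C-absorb k zero    = trans
    (cong (suc k *_) (k>n⇒nCk≡0 (s≤s (ℕ.≤-reflexive (ℕ.+-identityʳ k)))))
    (ℕ.*-zeroʳ (suc k))
  C-absorb k (suc j) = ℕ.*-cancelʳ-≡ _ _ (k ! * j !) {{k ℕ.!* j !≢0}} (begin
    suc k * ((k + suc j) C suc k) * (k ! * j !)
      ≡⟨ cong (λ n → suc k * (n C suc k) * (k ! * j !)) (ℕ.+-suc k j) ⟩
    suc k * ((suc k + j) C suc k) * (k ! * j !)
      ≡⟨ shuffle₁ (suc k) ((suc k + j) C suc k) (k !) (j !) ⟩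
    ((suc k + j) C suc k) * ((suc k) ! * j !)
      ≡⟨ C-! (suc k) j ⟩
    (suc k + j) !
      ≡⟨ cong _! (sym (ℕ.+-suc k j)) ⟩
    (k + suc j) !
      ≡⟨ sym (C-! k (suc j)) ⟩
    ((k + suc j) C k) * (k ! * (suc j) !)
      ≡⟨ shuffle₂ (suc j) ((k + suc j) C k) (k !) (j !) ⟩
    suc j * ((k + suc j) C k) * (k ! * j !) ∎)
    where
    shuffle₁ : ∀ p c x y → p * c * (x * y) ≡ c * (p * x * y)
    shuffle₁ = solve-∀
    shuffle₂ : ∀ p c x y → c * (x * (p * y)) ≡ p * c * (x * y)
    shuffle₂ = solve-∀

  -- (k+1) C(n,k)² = C(n+1,k) C(n,k) + (k+1) C(n,k-1) C(n,k+1)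
  NA-divisible : ∀ k j → suc k ∣ (suc (k + j) C k) * ((k + j) C k)
  NA-divisible zero    j = 1∣ _
  NA-divisible (suc k) j = ∣m+n∣m⇒∣n
    (subst (suc (suc k) ∣_) identity (m∣m*n (c * c))) (m∣m*n (b * d))
    where
    n = suc k + j
    b = n C k
    c = n C suc k
    d = n C suc (suc k)
    collect : ∀ j b c → b * (j * c) + (b + c) * c ≡ (c + suc j * b) * c
    collect = solve-∀
    shuffle : ∀ p b d → p * (b * d) ≡ b * (p * d)
    shuffle = solve-∀
    identity : suc (suc k) * (c * c) ≡ suc (suc k) * (b * d) + (suc n C suc k) * c
    identity = begin
      suc (suc k) * (c * c)
        ≡⟨ sym (ℕ.*-assoc (suc (suc k)) c c) ⟩
      (c + suc k * c) * c
        -- Absorption is used twice, as (k+1) c = (j+1) b here and as (k+2) d = j c below, together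
        -- with Pascal's rule for b + c.
        ≡⟨ cong (λ x → (c + x) * c)
             (subst (λ n → suc k * (n C suc k) ≡ suc j * (n C k)) (ℕ.+-suc k j) (C-absorb k (suc j))) ⟩
      (c + suc j * b) * c
        ≡⟨ sym (collect j b c) ⟩
      b * (j * c) + (b + c) * c
        ≡⟨ cong₂ (λ x y → b * x + y * c)
             (sym (C-absorb (suc k) j)) (nCk+nC[k+1]≡[n+1]C[k+1] n k) ⟩
      b * (suc (suc k) * d) + (suc n C suc k) * c
        ≡⟨ cong (_+ (suc n C suc k) * c) (sym (shuffle (suc (suc k)) b d)) ⟩
      suc (suc k) * (b * d) + (suc n C suc k) * c ∎

  NA-upper : ∀ {n k} → n ℕ.< k → NA n k ≡ 0
  NA-upper {n} {k} n<k with k ℕ.≤? n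
  ... | yes k≤n = ⊥-elim (ℕ.<⇒≱ n<k k≤n)
  ... | no  _   = refl

  NA-C : ∀ k j → NA (k + j) k * suc k ≡ (suc (k + j) C k) * ((k + j) C k)
  NA-C k j with k ℕ.≤? k + j
  ... | yes _   = m/n*n≡m (NA-divisible k j)
  ... | no  k≰n = ⊥-elim (k≰n (ℕ.m≤m+n k j))

  NA-! : ∀ k j → NA (k + j) k * (k ! * (1 + k) !) * (j ! * (1 + j) !) ≡ (k + j) ! * (1 + (k + j)) !
  NA-! k j = begin
    NA (k + j) k * (k ! * (suc k * k !)) * (j ! * (1 + j) !)
      ≡⟨ shuffle₁ (NA (k + j) k) (suc k) (k !) (j !) ((1 + j) !) ⟩
    NA (k + j) k * suc k * (k ! * k ! * (j ! * (1 + j) !))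
      ≡⟨ cong (_* (k ! * k ! * (j ! * (1 + j) !))) (NA-C k j) ⟩
    (suc (k + j) C k) * ((k + j) C k) * (k ! * k ! * (j ! * (1 + j) !))
      ≡⟨ shuffle₂ (suc (k + j) C k) ((k + j) C k) (k !) (j !) ((1 + j) !) ⟩
    ((k + j) C k) * (k ! * j !) * ((suc (k + j) C k) * (k ! * (1 + j) !))
      ≡⟨ cong₂ _*_ (C-! k j)
           (subst (λ n → (n C k) * (k ! * (1 + j) !) ≡ n !) (ℕ.+-suc k j) (C-! k (suc j))) ⟩
    (k + j) ! * (1 + (k + j)) ! ∎
    where
    shuffle₁ : ∀ n p x y z → n * (x * (p * x)) * (y * z) ≡ n * p * (x * x * (y * z))
    shuffle₁ = solve-∀
    shuffle₂ : ∀ c d x y z → c * d * (x * x * (y * z)) ≡ d * (x * y) * (c * (x * z))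
    shuffle₂ = solve-∀

  NB-upper : ∀ {n k} → n ℕ.< k → NB n k ≡ 0
  NB-upper n<k rewrite k>n⇒nCk≡0 n<k = refl

  NB-! : ∀ k j → NB (k + j) k * (k ! * k !) * (j ! * j !) ≡ (k + j) ! * (k + j) !
  NB-! k j = trans (shuffle ((k + j) C k) (k !) (j !)) (cong₂ _*_ (C-! k j) (C-! k j))
    where
    shuffle : ∀ c x y → c * c * (x * x) * (y * y) ≡ c * (x * y) * (c * (x * y))
    shuffle = solve-∀

  -- B n k = n! (a+n)! / (k! (a+k)! (n-k)! (a+n-k)!)
  record FactorialQuotient (a : ℕ) (B : ℕ → ℕ → ℕ) : Set where
    field
      upper : ∀ {n k} → n ℕ.< k → B n k ≡ 0
      lower : ∀ k j → B (k + j) k * (k ! * (a + k) !) * (j ! * (a + j) !)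
                    ≡ (k + j) ! * (a + (k + j)) !

  NA-factorialQuotient : FactorialQuotient 1 NA
  NA-factorialQuotient = record { upper = NA-upper ; lower = NA-! }

  NB-factorialQuotient : FactorialQuotient 0 NB
  NB-factorialQuotient = record { upper = NB-upper ; lower = NB-! }

  -- A polynomial in m of degree N (when n ≤ N) with leading coefficient B n k, which for every m
  -- is a row and column scaling of a Hurwitz matrix of bessel.
  inflated : ℕ → (ℕ → ℕ → ℕ) → ℕ → ℕ → ℕ → ℕ → ℕ
  inflated a B N m n k =
    B n k * (rise (m + (N ∸ (n ∸ k)) * 2) (n ∸ k) * rise (m + (a + N)) (N ∸ (n ∸ k)))

  -- Comparison of the inflated triangles with Hurwitz matrices

  module _ {a : ℕ} {B : ℕ → ℕ → ℕ} (B-quotient : FactorialQuotient a B) where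

    open FactorialQuotient B-quotient

    -- With N = j + ρ and i = m + 2ρ, the level m + 2N is 2j + i, so `bessel-closed` applies. The
    -- two `rise` factors are (i+j)! / i! and (a+i+j)! / (m+a+N)!, and the denominator j! (a+j)! is
    -- supplied by `B`.
    inflated-hurwitz-lower : ∀ m k j ρ →
      (k ! * (a + k) ! * (m + (a + (j + ρ))) !)
        * (B (k + j) k * (rise (m + ρ * 2) j * rise (m + (a + (j + ρ))) ρ))
      ≡ (k + j) ! * (a + (k + j)) ! * bessel (m + (j + ρ) * 2) a (j * 2)
    inflated-hurwitz-lower m k j ρ = ℕ.*-cancelʳ-≡ _ _ (i !) {{i ℕ.!≢0}} (begin
      k ! * (a + k) ! * (s !) * (b * (rise i j * rise s ρ)) * i !
        ≡⟨ shuffle₁ (k !) ((a + k) !) (s !) b (rise i j) (rise s ρ) (i !) ⟩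
      b * (k ! * (a + k) !) * ((rise i j * i !) * (rise s ρ * s !))
        ≡⟨ cong (b * (k ! * (a + k) !) *_) (cong₂ _*_ (rise-! i j) (trans (rise-! s ρ) (cong _! (index₁ a m j ρ)))) ⟩
      b * (k ! * (a + k) !) * ((i + j) ! * (a + i + j) !)
        ≡⟨ cong (b * (k ! * (a + k) !) *_) (sym (bessel-closed j i a)) ⟩
      b * (k ! * (a + k) !) * (g * (i ! * (j ! * (a + j) !)))
        ≡⟨ shuffle₂ (b * (k ! * (a + k) !)) g (i !) (j ! * (a + j) !) ⟩
      b * (k ! * (a + k) !) * (j ! * (a + j) !) * g * i !
        ≡⟨ cong₂ (λ x ν → x * bessel ν a (j * 2) * i !) (lower k j) (index₂ m j ρ) ⟩
      (k + j) ! * (a + (k + j)) ! * bessel (m + (j + ρ) * 2) a (j * 2) * i ! ∎)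
      where
      i = m + ρ * 2
      s = m + (a + (j + ρ))
      b = B (k + j) k
      g = bessel (j * 2 + i) a (j * 2)
      index₁ : ∀ a m j ρ → m + (a + (j + ρ)) + ρ ≡ a + (m + ρ * 2) + j
      index₁ = solve-∀
      index₂ : ∀ m j ρ → j * 2 + (m + ρ * 2) ≡ m + (j + ρ) * 2
      index₂ = solve-∀
      shuffle₁ : ∀ x y z b p q w → x * y * z * (b * (p * q)) * w ≡ b * (x * y) * (p * w * (q * z))
      shuffle₁ = solve-∀
      shuffle₂ : ∀ b g x y → b * (g * (x * y)) ≡ b * y * g * x
      shuffle₂ = solve-∀

    -- The factor on the left depends on the column `k` but not on the row `n`, the one on the right
    -- on `n` but not on `k`, so this is a scaling of columns and rows.
    inflated-hurwitz : ∀ N m {n} k → n ℕ.≤ N →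
      (k ! * (a + k) ! * (m + (a + N)) !) * inflated a B N m n k
      ≡ (n ! * (a + n) !) * hurwitz (bessel (m + N * 2) a) (n * 2) k
    inflated-hurwitz N m {n} k n≤N with k ℕ.≤? n
    ... | no  k≰n rewrite upper (ℕ.≰⇒> k≰n) | hurwitz-upper (bessel (m + N * 2) a) (ℕ.≰⇒> k≰n) =
      trans (ℕ.*-zeroʳ (k ! * (a + k) ! * (m + (a + N)) !)) (sym (ℕ.*-zeroʳ (n ! * (a + n) !)))
    ... | yes k≤n = lower-case (n ∸ k) (N ∸ (n ∸ k)) (ℕ.m+[n∸m]≡n k≤n)
        (ℕ.m+[n∸m]≡n (ℕ.≤-trans (ℕ.m∸n≤m n k) n≤N))
      where
      lower-case : ∀ j ρ → k + j ≡ n → j + ρ ≡ N →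
        (k ! * (a + k) ! * (m + (a + N)) !) * (B n k * (rise (m + ρ * 2) j * rise (m + (a + N)) ρ))
        ≡ (n ! * (a + n) !) * hurwitz (bessel (m + N * 2) a) (n * 2) k
      lower-case j ρ refl refl = trans (inflated-hurwitz-lower m k j ρ)
        (cong ((k + j) ! * (a + (k + j)) ! *_) (sym (hurwitz-even (bessel (m + (j + ρ) * 2) a) k j)))

open import Data.Integer using (+_; -_; _+_; _-_; _*_)

-- Determinants

∑-cong : ∀ {n} {f g : Fin n → ℤ} → (∀ i → f i ≡ g i) → ∑ f ≡ ∑ g
∑-cong {zero}  e = refl
∑-cong {suc n} e = cong₂ _+_ (e Fin.zero) (∑-cong (e ∘ Fin.suc))

∑-zero : ∀ {n} {f : Fin n → ℤ} → (∀ i → f i ≡ + 0) → ∑ f ≡ + 0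
∑-zero {zero}  e = refl
∑-zero {suc n} e = cong₂ _+_ (e Fin.zero) (∑-zero (e ∘ Fin.suc))

∑-nonneg : ∀ {n} {f : Fin n → ℤ} → (∀ i → + 0 ℤ.≤ f i) → + 0 ℤ.≤ ∑ f
∑-nonneg {zero}  h = ℤ.≤-refl
∑-nonneg {suc n} h = ℤ.+-mono-≤ (h Fin.zero) (∑-nonneg (h ∘ Fin.suc))

∑-linear : ∀ {n} (α β : ℤ) (f g : Fin n → ℤ) →
  ∑ (λ i → α * f i + β * g i) ≡ α * ∑ f + β * ∑ g
∑-linear {zero}  α β f g = sym (cong₂ _+_ (ℤ.*-zeroʳ α) (ℤ.*-zeroʳ β))
∑-linear {suc n} α β f g = trans
  (cong (_+_ (α * f Fin.zero + β * g Fin.zero)) (∑-linear α β (f ∘ Fin.suc) (g ∘ Fin.suc)))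
  (solve 6 (λ α β a b x y → (α :* a :+ β :* b) :+ (α :* x :+ β :* y)
                         := α :* (a :+ x) :+ β :* (b :+ y)) refl
     α β (f Fin.zero) (g Fin.zero) (∑ (f ∘ Fin.suc)) (∑ (g ∘ Fin.suc)))
  where open +-*-Solver

∑-scale : ∀ {n} (α : ℤ) (f : Fin n → ℤ) → ∑ (λ i → α * f i) ≡ α * ∑ f
∑-scale {zero}  α f = sym (ℤ.*-zeroʳ α)
∑-scale {suc n} α f = trans
  (cong (_+_ (α * f Fin.zero)) (∑-scale α (f ∘ Fin.suc)))
  (sym (ℤ.*-distribˡ-+ α (f Fin.zero) (∑ (f ∘ Fin.suc))))

cofactor : ∀ {n} → (Fin (suc n) → Fin (suc n) → ℤ) → Fin (suc n) → ℤ
cofactor M j = det (λ i k → M (Fin.suc i) (punchIn j k))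

laplace-term : ∀ {n} → (Fin (suc n) → Fin (suc n) → ℤ) → Fin (suc n) → ℤ
laplace-term M j = sgn (Fin.toℕ j) * (M Fin.zero j * cofactor M j)

det-cong : ∀ {n} {M N : Fin n → Fin n → ℤ} → (∀ i j → M i j ≡ N i j) → det M ≡ det N
det-cong {zero}  e = refl
det-cong {suc n} e = ∑-cong λ j → cong (sgn (Fin.toℕ j) *_)
  (cong₂ _*_ (e Fin.zero j) (det-cong λ i k → e (Fin.suc i) (punchIn j k)))

-- In the expansion along row 0, either the entries combine and the cofactors agree (`i` is row 0),
-- or the entries agree and the cofactors combine by induction.
det-row-linear : ∀ {n} (i : Fin n) (α β : ℤ) (M N P : Fin n → Fin n → ℤ) →
  (∀ k → M i k ≡ α * N i k + β * P i k) →
  (∀ j → j ≢ i → ∀ k → M j k ≡ N j k) →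
  (∀ j → j ≢ i → ∀ k → M j k ≡ P j k) →
  det M ≡ α * det N + β * det P
det-row-linear {suc n} Fin.zero α β M N P h hN hP = trans
  (∑-cong term) (∑-linear α β (laplace-term N) (laplace-term P))
  where
  open +-*-Solver
  term : ∀ j → laplace-term M j ≡ α * laplace-term N j + β * laplace-term P j
  term j
    rewrite h j
          | sym (det-cong {M = λ i k → M (Fin.suc i) (punchIn j k)}
                          (λ i k → hN (Fin.suc i) (λ ()) (punchIn j k)))
          | sym (det-cong {M = λ i k → M (Fin.suc i) (punchIn j k)}
                          (λ i k → hP (Fin.suc i) (λ ()) (punchIn j k)))
    = solve 6 (λ α β s x y d → s :* ((α :* x :+ β :* y) :* d)
                            := α :* (s :* (x :* d)) :+ β :* (s :* (y :* d))) refl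
        α β (sgn (Fin.toℕ j)) (N Fin.zero j) (P Fin.zero j) (cofactor M j)
det-row-linear {suc n} (Fin.suc i) α β M N P h hN hP = trans
  (∑-cong term) (∑-linear α β (laplace-term N) (laplace-term P))
  where
  open +-*-Solver
  term : ∀ j → laplace-term M j ≡ α * laplace-term N j + β * laplace-term P j
  term j
    rewrite sym (hN Fin.zero (λ ()) j)
          | sym (hP Fin.zero (λ ()) j)
          | det-row-linear i α β
              (λ i k → M (Fin.suc i) (punchIn j k))
              (λ i k → N (Fin.suc i) (punchIn j k))
              (λ i k → P (Fin.suc i) (punchIn j k))
              (λ k → h (punchIn j k))
              (λ l l≢i k → hN (Fin.suc l) (l≢i ∘ Fin.suc-injective) (punchIn j k))
              (λ l l≢i k → hP (Fin.suc l) (l≢i ∘ Fin.suc-injective) (punchIn j k))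
    = solve 6 (λ α β s m x y → s :* (m :* (α :* x :+ β :* y))
                            := α :* (s :* (m :* x)) :+ β :* (s :* (m :* y))) refl
        α β (sgn (Fin.toℕ j)) (M Fin.zero j) (cofactor N j) (cofactor P j)

-- The double Laplace expansion along two equal rows f. The terms with first pair of columns
-- (0 , k) and (k , 0) cancel; what is left is the same sum with column 0 removed.
double-expansion : ∀ n (f : Fin (suc (suc n)) → ℤ)
  (h : (Fin n → Fin (suc (suc n))) → ℤ) →
  (∀ {e e′} → (∀ x → e x ≡ e′ x) → h e ≡ h e′) →
  ∑ (λ j → sgn (Fin.toℕ j) * (f j *
    ∑ (λ k → sgn (Fin.toℕ k) * (f (punchIn j k) * h (λ x → punchIn j (punchIn k x))))))
  ≡ + 0
double-expansion n f h h-cong = begin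
  + 1 * (f₀ * ∑ X) + ∑ (λ j → - s j * (f (Fin.suc j) * (+ 1 * (f₀ * h (λ x → Fin.suc (punchIn j x))) + R j)))
    ≡⟨ cong (_+_ (+ 1 * (f₀ * ∑ X))) (trans (∑-cong split) (∑-linear (- f₀) (+ 1) X Y)) ⟩
  + 1 * (f₀ * ∑ X) + (- f₀ * ∑ X + + 1 * ∑ Y)
    ≡⟨ cong (λ y → + 1 * (f₀ * ∑ X) + (- f₀ * ∑ X + + 1 * y)) (rest n f h h-cong) ⟩
  + 1 * (f₀ * ∑ X) + (- f₀ * ∑ X + + 1 * + 0)
    ≡⟨ solve 2 (λ a x → con (+ 1) :* (a :* x) :+ (:- a :* x :+ con (+ 1) :* con (+ 0)) := con (+ 0)) refl f₀ (∑ X) ⟩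
  + 0 ∎
  where
  open ≡-Reasoning
  open +-*-Solver
  s : ∀ {n} → Fin n → ℤ
  s j = sgn (Fin.toℕ j)
  f₀ = f Fin.zero
  X R : Fin (suc n) → ℤ
  X j = s j * (f (Fin.suc j) * h (λ x → Fin.suc (punchIn j x)))
  R j = ∑ (λ k → - s k * (f (Fin.suc (punchIn j k)) * h (λ x → punchIn (Fin.suc j) (punchIn (Fin.suc k) x))))
  Y : Fin (suc n) → ℤ
  Y j = - s j * (f (Fin.suc j) * R j)
  split : ∀ j → - s j * (f (Fin.suc j) * (+ 1 * (f₀ * h (λ x → Fin.suc (punchIn j x))) + R j))
              ≡ - f₀ * X j + + 1 * Y j
  split j = solve 5 (λ s f f₀ h r → :- s :* (f :* (con (+ 1) :* (f₀ :* h) :+ r))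
                   := :- f₀ :* (s :* (f :* h)) :+ con (+ 1) :* (:- s :* (f :* r))) refl
              (s j) (f (Fin.suc j)) f₀ (h (λ x → Fin.suc (punchIn j x))) (R j)
  lift : ∀ {m n} → (Fin m → Fin n) → Fin (suc m) → Fin (suc n)
  lift e Fin.zero    = Fin.zero
  lift e (Fin.suc x) = Fin.suc (e x)
  -- Column 0 now always remains among the columns passed to `h`, so `lift` puts it back in front
  -- and `h ∘ lift` takes the place of `h`. The two minus signs cancel.
  rest : ∀ n (f : Fin (suc (suc n)) → ℤ) (h : (Fin n → Fin (suc (suc n))) → ℤ) →
    (∀ {e e′} → (∀ x → e x ≡ e′ x) → h e ≡ h e′) →
    ∑ (λ j → - s j * (f (Fin.suc j) *
      ∑ (λ k → - s k * (f (Fin.suc (punchIn j k)) * h (λ x → punchIn (Fin.suc j) (punchIn (Fin.suc k) x))))))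
    ≡ + 0
  rest zero    f h h-cong = ∑-zero λ j →
    trans (cong (- s j *_) (ℤ.*-zeroʳ (f (Fin.suc j)))) (ℤ.*-zeroʳ (- s j))
  rest (suc n) f h h-cong = trans (∑-cong term)
    (double-expansion n (f ∘ Fin.suc) (h ∘ lift) (λ e≗e′ → h-cong
      λ { Fin.zero → refl ; (Fin.suc x) → cong Fin.suc (e≗e′ x) }))
    where
    T : Fin (suc (suc n)) → Fin (suc n) → ℤ
    T j k = s k * (f (Fin.suc (punchIn j k)) * h (lift (λ x → punchIn j (punchIn k x))))
    inner : ∀ j k →
      - s k * (f (Fin.suc (punchIn j k)) * h (λ x → punchIn (Fin.suc j) (punchIn (Fin.suc k) x)))
      ≡ - (+ 1) * T j k
    inner j k = trans
      (cong (λ y → - s k * (f (Fin.suc (punchIn j k)) * y))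
        (h-cong λ { Fin.zero → refl ; (Fin.suc x) → refl }))
      (solve 2 (λ s y → :- s :* y := con (- (+ 1)) :* (s :* y)) refl (s k)
        (f (Fin.suc (punchIn j k)) * h (lift (λ x → punchIn j (punchIn k x)))))
    term : ∀ j → - s j * (f (Fin.suc j) *
        ∑ (λ k → - s k * (f (Fin.suc (punchIn j k)) * h (λ x → punchIn (Fin.suc j) (punchIn (Fin.suc k) x)))))
      ≡ s j * (f (Fin.suc j) * ∑ (T j))
    term j = trans
      (cong (λ y → - s j * (f (Fin.suc j) * y))
        (trans (∑-cong (inner j)) (∑-scale (- (+ 1)) (T j))))
      (solve 3 (λ s a t → :- s :* (a :* (con (- (+ 1)) :* t)) := s :* (a :* t)) refl
        (s j) (f (Fin.suc j)) (∑ (T j)))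

-- Equality of the first two rows is the case of `double-expansion`; equal rows further down persist
-- in every cofactor. Adjacent rows are enough for index sequences that are monotone.
det-adjacent-rows-equal : ∀ {n} (M : Fin (suc n) → Fin (suc n) → ℤ) (i : Fin n) →
  (∀ k → M (inject₁ i) k ≡ M (Fin.suc i) k) → det M ≡ + 0
det-adjacent-rows-equal {suc n} M Fin.zero e = trans
  (∑-cong λ j → cong (λ y → sgn (Fin.toℕ j) * (M Fin.zero j * y))
    (∑-cong λ k → cong (λ y → sgn (Fin.toℕ k) *
        (y * det (λ i x → M (Fin.suc (Fin.suc i)) (punchIn j (punchIn k x)))))
      (sym (e (punchIn j k)))))
  (double-expansion n (M Fin.zero) (λ e → det (λ i x → M (Fin.suc (Fin.suc i)) (e x)))
    (λ e≗e′ → det-cong λ i x → cong (M (Fin.suc (Fin.suc i))) (e≗e′ x)))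
det-adjacent-rows-equal {suc n} M (Fin.suc i) e = ∑-zero λ j → trans
  (cong (λ y → sgn (Fin.toℕ j) * (M Fin.zero j * y))
    (det-adjacent-rows-equal (λ i k → M (Fin.suc i) (punchIn j k)) i (λ k → e (punchIn j k))))
  (trans (cong (sgn (Fin.toℕ j) *_) (ℤ.*-zeroʳ (M Fin.zero j))) (ℤ.*-zeroʳ (sgn (Fin.toℕ j))))

-- Expanding along row 0, the first term has a zero entry and every other cofactor still contains
-- the zero column.
det-first-column-zero : ∀ {n} (M : Fin (suc n) → Fin (suc n) → ℤ) →
  (∀ i → M i Fin.zero ≡ + 0) → det M ≡ + 0
det-first-column-zero M e = ∑-zero term
  where
  cofactor-zero : ∀ {n} (M : Fin (suc n) → Fin (suc n) → ℤ) → (∀ i → M i Fin.zero ≡ + 0) →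
    ∀ j → cofactor M (Fin.suc j) ≡ + 0
  cofactor-zero {suc n} M e j = det-first-column-zero (λ i k → M (Fin.suc i) (punchIn (Fin.suc j) k)) (e ∘ Fin.suc)
  term : ∀ j → laplace-term M j ≡ + 0
  term Fin.zero    = trans (ℤ.*-identityˡ _) (cong (_* cofactor M Fin.zero) (e Fin.zero))
  term (Fin.suc j) = trans
    (cong (λ y → sgn (suc (Fin.toℕ j)) * (M Fin.zero (Fin.suc j) * y)) (cofactor-zero M e j))
    (trans (cong (sgn (suc (Fin.toℕ j)) *_) (ℤ.*-zeroʳ (M Fin.zero (Fin.suc j))))
           (ℤ.*-zeroʳ (sgn (suc (Fin.toℕ j)))))

-- Scaling of rows and columns

∏ : ∀ {n} → (Fin n → ℤ) → ℤ
∏ {zero}  f = + 1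
∏ {suc n} f = f Fin.zero * ∏ (f ∘ Fin.suc)

∏-punchIn : ∀ {n} (f : Fin (suc n) → ℤ) j → f j * ∏ (f ∘ punchIn j) ≡ ∏ f
∏-punchIn         f Fin.zero    = refl
∏-punchIn {suc n} f (Fin.suc j) = trans
  (solve 3 (λ x y z → x :* (y :* z) := y :* (x :* z)) refl
    (f (Fin.suc j)) (f Fin.zero) (∏ (f ∘ Fin.suc ∘ punchIn j)))
  (cong (f Fin.zero *_) (∏-punchIn (f ∘ Fin.suc) j))
  where open +-*-Solver

∏-positive : ∀ {n} (f : Fin n → ℤ) → (∀ i → + 0 ℤ.< f i) → + 0 ℤ.< ∏ f
∏-positive {zero}  f p = ℤ.+<+ (s≤s z≤n)
∏-positive {suc n} f p = subst (ℤ._< f Fin.zero * ∏ (f ∘ Fin.suc)) (ℤ.*-zeroʳ (f Fin.zero))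
  (ℤ.*-monoˡ-<-pos (f Fin.zero) {{ℤ.positive (p Fin.zero)}} (∏-positive (f ∘ Fin.suc) (p ∘ Fin.suc)))

det-scale-rows : ∀ {n} (ρ : Fin n → ℤ) (M : Fin n → Fin n → ℤ) →
  det (λ i j → ρ i * M i j) ≡ ∏ ρ * det M
det-scale-rows {zero}  ρ M = refl
det-scale-rows {suc n} ρ M = trans (∑-cong term) (∑-scale (∏ ρ) (laplace-term M))
  where
  open +-*-Solver
  term : ∀ j →
    sgn (Fin.toℕ j) * (ρ Fin.zero * M Fin.zero j * det (λ i k → ρ (Fin.suc i) * M (Fin.suc i) (punchIn j k)))
    ≡ ∏ ρ * laplace-term M j
  term j = trans
    (cong (λ y → sgn (Fin.toℕ j) * (ρ Fin.zero * M Fin.zero j * y))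
      (det-scale-rows (ρ ∘ Fin.suc) (λ i k → M (Fin.suc i) (punchIn j k))))
    (solve 5 (λ s r m p d → s :* (r :* m :* (p :* d)) := r :* p :* (s :* (m :* d))) refl
      (sgn (Fin.toℕ j)) (ρ Fin.zero) (M Fin.zero j) (∏ (ρ ∘ Fin.suc))
      (cofactor M j))

det-scale-columns : ∀ {n} (κ : Fin n → ℤ) (M : Fin n → Fin n → ℤ) →
  det (λ i j → κ j * M i j) ≡ ∏ κ * det M
det-scale-columns {zero}  κ M = refl
det-scale-columns {suc n} κ M = trans (∑-cong term) (∑-scale (∏ κ) (laplace-term M))
  where
  open +-*-Solver
  term : ∀ j →
    sgn (Fin.toℕ j) * (κ j * M Fin.zero j * det (λ i k → κ (punchIn j k) * M (Fin.suc i) (punchIn j k)))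
    ≡ ∏ κ * laplace-term M j
  term j = trans
    (cong (λ y → sgn (Fin.toℕ j) * (κ j * M Fin.zero j * y))
      (det-scale-columns (κ ∘ punchIn j) (λ i k → M (Fin.suc i) (punchIn j k))))
    (trans
      (solve 5 (λ s r m p d → s :* (r :* m :* (p :* d)) := r :* p :* (s :* (m :* d))) refl
        (sgn (Fin.toℕ j)) (κ j) (M Fin.zero j) (∏ (κ ∘ punchIn j))
        (cofactor M j))
      (cong (_* laplace-term M j)
        (∏-punchIn κ j)))

-- Total positivity

*-nonneg : ∀ {x y} → + 0 ℤ.≤ x → + 0 ℤ.≤ y → + 0 ℤ.≤ x * y
*-nonneg {+ m} {+ n} _ _ = subst (+ 0 ℤ.≤_) (ℤ.pos-* m n) (+≤+ z≤n)

-- Only the first term of the Laplace expansion can be nonzero: a nonzero entry of the first row in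
-- a later column forces the first column of the minor to vanish, hence also the cofactor. What is
-- left is an entry times a smaller minor.
echelon-totallyPositive : ∀ {A : InfMatrix} →
  (∀ i k → + 0 ℤ.≤ A i k) →
  (∀ {i i′ k k′} → i ℕ.≤ i′ → k′ ℕ.< k → A i k ≢ + 0 → A i′ k′ ≡ + 0) →
  TotallyPositive A
echelon-totallyPositive nonneg echelon zero r c r↑ c↑ = +≤+ z≤n
echelon-totallyPositive {A} nonneg echelon (suc n) r c r↑ c↑ = ∑-nonneg term
  where
  M : Fin (suc n) → Fin (suc n) → ℤ
  M i j = A (r i) (c j)
  zero-term : ∀ j → M Fin.zero j * cofactor M j ≡ + 0 → + 0 ℤ.≤ laplace-term M j
  zero-term j e = ℤ.≤-reflexive (sym (trans (cong (sgn (Fin.toℕ j) *_) e) (ℤ.*-zeroʳ (sgn (Fin.toℕ j)))))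
  cofactor-zero : ∀ {n} (r c : Fin (suc n) → ℕ) j →
    (∀ i → A (r i) (c Fin.zero) ≡ + 0) → cofactor (λ i j → A (r i) (c j)) (Fin.suc j) ≡ + 0
  cofactor-zero {suc n} r c j e =
    det-first-column-zero (λ i k → A (r (Fin.suc i)) (c (punchIn (Fin.suc j) k))) (e ∘ Fin.suc)
  term : ∀ j → + 0 ℤ.≤ laplace-term M j
  term Fin.zero = subst (+ 0 ℤ.≤_) (sym (ℤ.*-identityˡ _))
    (*-nonneg (nonneg _ _)
      (echelon-totallyPositive nonneg echelon n (r ∘ Fin.suc) (c ∘ Fin.suc)
        (λ i j i<j → r↑ (Fin.suc i) (Fin.suc j) (s≤s i<j))
        (λ i j i<j → c↑ (Fin.suc i) (Fin.suc j) (s≤s i<j))))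
  term (Fin.suc j) with M Fin.zero (Fin.suc j) ℤ.≟ + 0
  ... | yes e = zero-term (Fin.suc j) (cong (_* cofactor M (Fin.suc j)) e)
  ... | no ≢0 = zero-term (Fin.suc j) (trans
    (cong (M Fin.zero (Fin.suc j) *_)
      (cofactor-zero r c j λ i → echelon (r₀≤ i) (c↑ Fin.zero (Fin.suc j) (s≤s z≤n)) ≢0))
    (ℤ.*-zeroʳ (M Fin.zero (Fin.suc j))))
    where
    r₀≤ : ∀ i → r Fin.zero ℕ.≤ r i
    r₀≤ Fin.zero    = ℕ.≤-refl
    r₀≤ (Fin.suc i) = ℕ.<⇒≤ (r↑ Fin.zero (Fin.suc i) (s≤s z≤n))

StrictlyIncreasing⇒monotone : ∀ {n} {r : Fin n → ℕ} → StrictlyIncreasing r →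
  ∀ {i j} → i Fin.≤ j → r i ℕ.≤ r j
StrictlyIncreasing⇒monotone {r = r} r↑ {i} {j} i≤j with i Fin.≟ j
... | yes refl = ℕ.≤-refl
... | no  i≢j  = ℕ.<⇒≤ (r↑ i j (Fin.≤∧≢⇒< i≤j i≢j))

StrictlyIncreasing⇒injective : ∀ {n} {r : Fin n → ℕ} → StrictlyIncreasing r →
  ∀ {i j} → r i ≡ r j → i ≡ j
StrictlyIncreasing⇒injective r↑ {i} {j} e with Fin.<-cmp i j
... | tri< i<j _ _ = ⊥-elim (ℕ.<⇒≢ (r↑ i j i<j) e)
... | tri≈ _ i≡j _ = i≡j
... | tri> _ _ j<i = ⊥-elim (ℕ.<⇒≢ (r↑ j i j<i) (sym e))

-- A weakly increasing sequence either repeats a value at adjacent places, which makes the minor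
-- zero, or is strictly increasing. This covers the sequences in which one row index has been
-- lowered.
monotone-minor-nonneg : ∀ (A : InfMatrix) {n} (r c : Fin n → ℕ) →
  (∀ {i j} → i Fin.≤ j → r i ℕ.≤ r j) →
  (StrictlyIncreasing r → + 0 ℤ.≤ minor A r c) → + 0 ℤ.≤ minor A r c
monotone-minor-nonneg A {zero}  r c r-mono strict = +≤+ z≤n
monotone-minor-nonneg A {suc n} r c r-mono strict
  with Fin.any? (λ i → r (inject₁ i) ℕ.≟ r (Fin.suc i))
... | yes (i , e) = ℤ.≤-reflexive (sym
        (det-adjacent-rows-equal (λ i j → A (r i) (c j)) i (λ k → cong (λ x → A x (c k)) e)))
... | no  ¬adj    = strict r↑
  where
  r↑ : StrictlyIncreasing r
  r↑ i (Fin.suc j) (s≤s i≤j) = ℕ.≤-<-trans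
    (r-mono (subst (Fin.toℕ i ℕ.≤_) (sym (Fin.toℕ-inject₁ j)) i≤j))
    (ℕ.≤∧≢⇒< (r-mono (subst (ℕ._≤ suc (Fin.toℕ j)) (sym (Fin.toℕ-inject₁ j)) (ℕ.n≤1+n _)))
             (λ e → ¬adj (j , e)))

lower : ℕ → ℕ → ℕ
lower t i with i ℕ.≟ t
... | yes _ = ℕ.pred i
... | no  _ = i

lower-mono : ∀ t {i j} → i ℕ.≤ j → lower t i ℕ.≤ lower t j
lower-mono t {i} {j} i≤j with i ℕ.≟ t | j ℕ.≟ t
... | yes _ | yes _ = ℕ.pred-mono-≤ i≤j
... | yes _ | no  _ = ℕ.≤-trans ℕ.pred[n]≤n i≤j
... | no  _ | no  _ = i≤j
... | no i≢ | yes e = ℕ.≤-trans (ℕ.pred-mono-≤ (ℕ.≤∧≢⇒< i≤j (λ i≡j → i≢ (trans i≡j e)))) ℕ.≤-refl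

lower-≤ : ∀ t i → lower t i ℕ.≤ i
lower-≤ t i with i ℕ.≟ t
... | yes _ = ℕ.pred[n]≤n
... | no  _ = ℕ.≤-refl

lower-≡ : ∀ t → lower t t ≡ ℕ.pred t
lower-≡ t with t ℕ.≟ t
... | yes _ = refl
... | no t≢ = ⊥-elim (t≢ refl)

lower-≢ : ∀ t {i} → i ≢ t → lower t i ≡ i
lower-≢ t {i} i≢t with i ℕ.≟ t
... | yes e = ⊥-elim (i≢t e)
... | no  _ = refl

-- Multiplication by a bidiagonal matrix

module _ {A B : InfMatrix} (α β : ℕ → ℕ)
  (A≡LB : ∀ i k → A i k ≡ + α i * B i k + + β i * B (ℕ.pred i) k) where

  -- Interpolates between `A` at t = 0 and `B` for large `t`; raising `t` by one changes a single
  -- row, so that linearity of the determinant in that row applies.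
  mix : ℕ → InfMatrix
  mix t i with i ℕ.<? t
  ... | yes _ = B i
  ... | no  _ = A i

  mix-< : ∀ {t i} → i ℕ.< t → ∀ k → mix t i k ≡ B i k
  mix-< {t} {i} i<t k with i ℕ.<? t
  ... | yes _   = refl
  ... | no  i≮t = ⊥-elim (i≮t i<t)

  mix-≥ : ∀ {t i} → t ℕ.≤ i → ∀ k → mix t i k ≡ A i k
  mix-≥ {t} {i} t≤i k with i ℕ.<? t
  ... | yes i<t = ⊥-elim (ℕ.<⇒≱ i<t t≤i)
  ... | no  _   = refl

  mix-step : ∀ t {i} → i ≢ t → ∀ k → mix t i k ≡ mix (suc t) i k
  mix-step t {i} i≢t k with ℕ.<-cmp i t
  ... | tri< i<t _ _ = trans (mix-< i<t k) (sym (mix-< (ℕ.m<n⇒m<1+n i<t) k))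
  ... | tri≈ _ i≡t _ = ⊥-elim (i≢t i≡t)
  ... | tri> _ _ t<i = trans (mix-≥ (ℕ.<⇒≤ t<i) k) (sym (mix-≥ t<i k))

  -- Rows t and t - 1 of `mix (suc t)` both come from `B` already, so the relation between `A` and
  -- `B` becomes one between rows of consecutive mixtures. This is why the rows are replaced in
  -- increasing order.
  mix-row : ∀ t k → mix t t k ≡ + α t * mix (suc t) t k + + β t * mix (suc t) (ℕ.pred t) k
  mix-row t k = trans (mix-≥ {t} ℕ.≤-refl k) (trans (A≡LB t k)
    (cong₂ (λ x y → + α t * x + + β t * y)
      (sym (mix-< {suc t} ℕ.≤-refl k)) (sym (mix-< (s≤s (ℕ.pred[n]≤n {t})) k))))

  -- Passing from row t of A to rows t and t - 1 of B, one row at a time: a minor containing row t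
  -- splits into the same minor and one with row t lowered, which vanishes if t - 1 was present.
  mix-minor-nonneg : TotallyPositive B → ∀ d t {n} (r c : Fin n → ℕ) →
    StrictlyIncreasing r → StrictlyIncreasing c →
    (∀ i → r i ℕ.< d ℕ.+ t) → + 0 ℤ.≤ minor (mix t) r c
  -- `d` bounds the number of rows still to be replaced; at zero all rows of the minor are rows of
  -- `B`.
  mix-minor-nonneg B-TP zero t {n} r c r↑ c↑ r< = subst (+ 0 ℤ.≤_)
    (sym (det-cong λ i j → mix-< (r< i) (c j))) (B-TP n r c r↑ c↑)
  mix-minor-nonneg B-TP (suc d) t r c r↑ c↑ r< with Fin.any? (λ i → r i ℕ.≟ t)
  ... | no ¬t∈r = subst (+ 0 ℤ.≤_)
    (sym (det-cong λ i j → mix-step t (λ e → ¬t∈r (i , e)) (c j)))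
    (mix-minor-nonneg B-TP d (suc t) r c r↑ c↑
      (λ i → subst (r i ℕ.<_) (sym (ℕ.+-suc d t)) (r< i)))
  ... | yes (i , refl) = subst (+ 0 ℤ.≤_)
    (sym (det-row-linear i (+ α t) (+ β t)
      (λ i j → mix t (r i) (c j)) (λ i j → mix (suc t) (r i) (c j))
      (λ i j → mix (suc t) (lower t (r i)) (c j))
      (λ k → trans (mix-row t (c k))
        (cong (λ x → + α t * mix (suc t) t (c k) + + β t * mix (suc t) x (c k)) (sym (lower-≡ t))))
      (λ j j≢i k → mix-step t (other j≢i) (c k))
      (λ j j≢i k → trans (mix-step t (other j≢i) (c k))
        (cong (λ x → mix (suc t) x (c k)) (sym (lower-≢ t (other j≢i)))))))
    (ℤ.+-mono-≤
      (*-nonneg {+ α t} (+≤+ z≤n) (mix-minor-nonneg B-TP d (suc t) r c r↑ c↑ r<′))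
      (*-nonneg {+ β t} (+≤+ z≤n) (monotone-minor-nonneg (mix (suc t)) (lower t ∘ r) c
        (λ i≤j → lower-mono t (StrictlyIncreasing⇒monotone r↑ i≤j))
        (λ lr↑ → mix-minor-nonneg B-TP d (suc t) (lower t ∘ r) c lr↑ c↑
          (λ j → ℕ.≤-<-trans (lower-≤ t (r j)) (r<′ j))))))
    where
    r<′ : ∀ j → r j ℕ.< d ℕ.+ suc t
    r<′ j = subst (r j ℕ.<_) (sym (ℕ.+-suc d t)) (r< j)
    other : ∀ {j} → j ≢ i → r j ≢ t
    other j≢i e = j≢i (StrictlyIncreasing⇒injective r↑ e)

-- A minor meets finitely many rows, so finitely many replacements, and later one common degree `N`,
-- are enough for it.
bounded : ∀ {n} (r : Fin n → ℕ) → ∃ λ N → ∀ i → r i ℕ.≤ N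
bounded {zero}  r = 0 , λ ()
bounded {suc n} r with bounded (r ∘ Fin.suc)
... | N , r≤N = r Fin.zero ℕ.⊔ N , λ
  { Fin.zero    → ℕ.m≤m⊔n (r Fin.zero) N
  ; (Fin.suc i) → ℕ.≤-trans (r≤N i) (ℕ.m≤n⊔m (r Fin.zero) N) }

bidiagonal-totallyPositive : ∀ {A B : InfMatrix} (α β : ℕ → ℕ) →
  (∀ i k → A i k ≡ + α i * B i k + + β i * B (ℕ.pred i) k) →
  TotallyPositive B → TotallyPositive A
bidiagonal-totallyPositive {A} {B} α β A≡LB B-TP n r c r↑ c↑ with bounded r
... | N , r≤N = subst (+ 0 ℤ.≤_) (det-cong λ i j → mix-≥ α β A≡LB z≤n (c j))
  (mix-minor-nonneg α β A≡LB B-TP (suc N) 0 r c r↑ c↑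
    (λ i → s≤s (subst (r i ℕ.≤_) (sym (ℕ.+-identityʳ N)) (r≤N i))))

-- Total positivity of the Hurwitz matrices

Hurwitz : (ℕ → ℕ) → InfMatrix
Hurwitz f i k = + hurwitz f i k

-- The recursion stops at the sequence 1, 0, 0, ..., whose matrix has its only nonzero entries at
-- the positions (2k, k) and is in echelon form. Each earlier matrix is a nonnegative bidiagonal
-- matrix times the next.
Hurwitz-totallyPositive : ∀ ν a → TotallyPositive (Hurwitz (bessel ν a))
Hurwitz-totallyPositive zero a = echelon-totallyPositive (λ i k → +≤+ z≤n) echelon
  where
  echelon : ∀ {i i′ k k′} → i ℕ.≤ i′ → k′ ℕ.< k →
    Hurwitz (bessel 0 a) i k ≢ + 0 → Hurwitz (bessel 0 a) i′ k′ ≡ + 0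
  echelon {i} {i′} {k} {k′} i≤i′ k′<k ≢0 with hurwitz (bessel 0 a) i′ k′ ℕ.≟ 0
  ... | yes e  = cong +_ e
  ... | no ≢0′ = ⊥-elim (ℕ.<⇒≱ (ℕ.*-monoˡ-< 2 k′<k)
    (subst₂ ℕ._≤_ (hurwitz-support a i k (λ e → ≢0 (cong +_ e))) (hurwitz-support a i′ k′ ≢0′) i≤i′))
Hurwitz-totallyPositive (suc ν) a =
  bidiagonal-totallyPositive (weight a) below
    (λ i k → trans (cong +_ (hurwitz-bessel ν a i k)) (trans (ℤ.pos-+ (weight a i ℕ.* H i k) (below i ℕ.* H (ℕ.pred i) k))
       (cong₂ _+_ (ℤ.pos-* (weight a i) (H i k)) (ℤ.pos-* (below i) (H (ℕ.pred i) k)))))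
    (Hurwitz-totallyPositive ν (suc a))
  where
  H = hurwitz (bessel ν (suc a))

-- Leading coefficients

infix 4 _∼_[1+m]^_

-- u m = L (m + 1) ^ d + O ((m + 1) ^ (d - 1)), multiplied by m + 1 to avoid the exponent d - 1.
record _∼_[1+m]^_ (u : ℕ → ℤ) (L : ℤ) (d : ℕ) : Set where
  constructor asymptotics
  field
    constant : ℕ
    bound    : ∀ m → suc m ℕ.* ∣ u m - L * + (suc m ℕ.^ d) ∣ ℕ.≤ constant ℕ.* suc m ℕ.^ d

∼-cong : ∀ {u v L d} → (∀ m → u m ≡ v m) → u ∼ L [1+m]^ d → v ∼ L [1+m]^ d
∼-cong {L = L} {d} e (asymptotics C h) = asymptotics C λ m →
  subst (λ x → suc m ℕ.* ∣ x - L * + (suc m ℕ.^ d) ∣ ℕ.≤ C ℕ.* suc m ℕ.^ d) (e m) (h m)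

∼-const : ∀ L → (λ _ → L) ∼ L [1+m]^ 0
∼-const L = asymptotics 0 λ m → ℕ.≤-reflexive (trans
  (cong (λ x → suc m ℕ.* ∣ x ∣) (trans (cong (λ y → L - y) (ℤ.*-identityʳ L)) (ℤ.+-inverseʳ L)))
  (ℕ.*-zeroʳ (suc m)))

∼-zero : ∀ d → (λ _ → + 0) ∼ + 0 [1+m]^ d
∼-zero d = asymptotics 0 λ m → ℕ.≤-reflexive (ℕ.*-zeroʳ (suc m))

∼-+ : ∀ {u v K L d} → u ∼ K [1+m]^ d → v ∼ L [1+m]^ d → (λ m → u m + v m) ∼ K + L [1+m]^ d
∼-+ {u} {v} {K} {L} {d} (asymptotics C h) (asymptotics D k) = asymptotics (C ℕ.+ D) bound
  where
  open +-*-Solver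
  open ℕ.≤-Reasoning
  bound : ∀ m → suc m ℕ.* ∣ u m + v m - (K + L) * + (suc m ℕ.^ d) ∣ ℕ.≤ (C ℕ.+ D) ℕ.* suc m ℕ.^ d
  bound m = begin
    suc m ℕ.* ∣ u m + v m - (K + L) * + P ∣
      ≡⟨ cong (λ x → suc m ℕ.* ∣ x ∣) (solve 5 (λ u v K L P →
           u :+ v :- (K :+ L) :* P := (u :- K :* P) :+ (v :- L :* P)) refl (u m) (v m) K L (+ P)) ⟩
    suc m ℕ.* ∣ (u m - K * + P) + (v m - L * + P) ∣
      ≤⟨ ℕ.*-monoʳ-≤ (suc m) (ℤ.∣i+j∣≤∣i∣+∣j∣ (u m - K * + P) (v m - L * + P)) ⟩
    suc m ℕ.* (∣ u m - K * + P ∣ ℕ.+ ∣ v m - L * + P ∣)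
      ≡⟨ ℕ.*-distribˡ-+ (suc m) (∣ u m - K * + P ∣) (∣ v m - L * + P ∣) ⟩
    suc m ℕ.* ∣ u m - K * + P ∣ ℕ.+ suc m ℕ.* ∣ v m - L * + P ∣
      ≤⟨ ℕ.+-mono-≤ (h m) (k m) ⟩
    C ℕ.* P ℕ.+ D ℕ.* P
      ≡⟨ sym (ℕ.*-distribʳ-+ P C D) ⟩
    (C ℕ.+ D) ℕ.* P ∎
    where P = suc m ℕ.^ d

∼-* : ∀ {u v K L d e} → u ∼ K [1+m]^ d → v ∼ L [1+m]^ e → (λ m → u m * v m) ∼ K * L [1+m]^ (d ℕ.+ e)
∼-* {u} {v} {K} {L} {d} {e} (asymptotics C h) (asymptotics D k) =
  asymptotics (C ℕ.* D ℕ.+ (C ℕ.* ∣ L ∣ ℕ.+ ∣ K ∣ ℕ.* D)) bound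
  where
  open +-*-Solver
  open ℕ.≤-Reasoning
  expand : ∀ a b M P Q K L → M ℕ.* (a ℕ.* b ℕ.+ (a ℕ.* (L ℕ.* Q) ℕ.+ K ℕ.* P ℕ.* b))
    ≡ M ℕ.* (a ℕ.* b) ℕ.+ (M ℕ.* a ℕ.* (L ℕ.* Q) ℕ.+ K ℕ.* P ℕ.* (M ℕ.* b))
  expand = solve-∀
  regroup : ∀ C D K L P Q → C ℕ.* P ℕ.* (D ℕ.* Q) ℕ.+ (C ℕ.* P ℕ.* (L ℕ.* Q) ℕ.+ K ℕ.* P ℕ.* (D ℕ.* Q))
    ≡ (C ℕ.* D ℕ.+ (C ℕ.* L ℕ.+ K ℕ.* D)) ℕ.* (P ℕ.* Q)
  regroup = solve-∀
  interchange : ∀ M a b → M ℕ.* a ℕ.* (M ℕ.* b) ≡ M ℕ.* (M ℕ.* (a ℕ.* b))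
  interchange = solve-∀
  bound : ∀ m → suc m ℕ.* ∣ u m * v m - K * L * + (suc m ℕ.^ (d ℕ.+ e)) ∣
    ℕ.≤ (C ℕ.* D ℕ.+ (C ℕ.* ∣ L ∣ ℕ.+ ∣ K ∣ ℕ.* D)) ℕ.* suc m ℕ.^ (d ℕ.+ e)
  bound m rewrite ℕ.^-distribˡ-+-* (suc m) d e = begin
    M ℕ.* ∣ u m * v m - K * L * + (P ℕ.* Q) ∣
      ≡⟨ cong (λ x → M ℕ.* ∣ x ∣) (trans
           (cong (λ y → u m * v m - K * L * y) (ℤ.pos-* P Q))
           (solve 6 (λ u v K L P Q → u :* v :- K :* L :* (P :* Q)
              := (u :- K :* P) :* (v :- L :* Q) :+ ((u :- K :* P) :* (L :* Q) :+ K :* P :* (v :- L :* Q)))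
              refl (u m) (v m) K L (+ P) (+ Q))) ⟩
    M ℕ.* ∣ a * b + (a * (L * + Q) + K * + P * b) ∣
      ≤⟨ ℕ.*-monoʳ-≤ M (ℕ.≤-trans (ℤ.∣i+j∣≤∣i∣+∣j∣ (a * b) _)
           (ℕ.+-monoʳ-≤ (∣ a * b ∣) (ℤ.∣i+j∣≤∣i∣+∣j∣ (a * (L * + Q)) _))) ⟩
    M ℕ.* (∣ a * b ∣ ℕ.+ (∣ a * (L * + Q) ∣ ℕ.+ ∣ K * + P * b ∣))
      ≡⟨ cong (M ℕ.*_) (cong₂ ℕ._+_ (ℤ.abs-* a b) (cong₂ ℕ._+_
           (trans (ℤ.abs-* a (L * + Q)) (cong (∣ a ∣ ℕ.*_) (ℤ.abs-* L (+ Q))))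
           (trans (ℤ.abs-* (K * + P) b) (cong (ℕ._* ∣ b ∣) (ℤ.abs-* K (+ P)))))) ⟩
    M ℕ.* (∣ a ∣ ℕ.* ∣ b ∣ ℕ.+ (∣ a ∣ ℕ.* (∣ L ∣ ℕ.* Q) ℕ.+ ∣ K ∣ ℕ.* P ℕ.* ∣ b ∣))
      ≡⟨ expand (∣ a ∣) (∣ b ∣) M P Q (∣ K ∣) (∣ L ∣) ⟩
    M ℕ.* (∣ a ∣ ℕ.* ∣ b ∣) ℕ.+ (M ℕ.* ∣ a ∣ ℕ.* (∣ L ∣ ℕ.* Q) ℕ.+ ∣ K ∣ ℕ.* P ℕ.* (M ℕ.* ∣ b ∣))
      ≤⟨ ℕ.+-mono-≤
           -- The product of the two errors comes with one factor m + 1, but bounding both errors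
           -- takes two; the second is inserted at the cost of an inequality.
           (ℕ.≤-trans (ℕ.m≤n*m _ M) (ℕ.≤-trans (ℕ.≤-reflexive (sym (interchange M (∣ a ∣) (∣ b ∣))))
             (ℕ.*-mono-≤ (h m) (k m))))
           (ℕ.+-mono-≤ (ℕ.*-monoˡ-≤ (∣ L ∣ ℕ.* Q) (h m)) (ℕ.*-monoʳ-≤ (∣ K ∣ ℕ.* P) (k m))) ⟩
    C ℕ.* P ℕ.* (D ℕ.* Q) ℕ.+ (C ℕ.* P ℕ.* (∣ L ∣ ℕ.* Q) ℕ.+ ∣ K ∣ ℕ.* P ℕ.* (D ℕ.* Q))
      ≡⟨ regroup C D (∣ K ∣) (∣ L ∣) P Q ⟩
    (C ℕ.* D ℕ.+ (C ℕ.* ∣ L ∣ ℕ.+ ∣ K ∣ ℕ.* D)) ℕ.* (P ℕ.* Q) ∎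
    where
    M = suc m
    P = suc m ℕ.^ d
    Q = suc m ℕ.^ e
    a b : ℤ
    a = u m - K * + P
    b = v m - L * + Q

∼-linear : ∀ c → (λ m → + suc (m ℕ.+ c)) ∼ + 1 [1+m]^ 1
∼-linear c = asymptotics c λ m → ℕ.≤-reflexive (trans
  (cong (λ x → suc m ℕ.* ∣ x ∣) (error m))
  (trans (ℕ.*-comm (suc m) c) (cong (c ℕ.*_) (sym (ℕ.^-identityʳ (suc m))))))
  where
  open +-*-Solver
  error : ∀ m → + suc (m ℕ.+ c) - + 1 * + (suc m ℕ.^ 1) ≡ + c
  error m = trans (cong₂ (λ x y → x - + 1 * y) (ℤ.pos-+ (suc m) c) (cong +_ (ℕ.^-identityʳ (suc m))))
    (solve 2 (λ x c → x :+ c :- con (+ 1) :* x := c) refl (+ suc m) (+ c))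

∼-∑ : ∀ {n} {u : ℕ → Fin n → ℤ} {L : Fin n → ℤ} {d} →
  (∀ i → (λ m → u m i) ∼ L i [1+m]^ d) → (λ m → ∑ (u m)) ∼ ∑ L [1+m]^ d
∼-∑ {zero}  {d = d} h = ∼-zero d
∼-∑ {suc n} {u} {L} h = ∼-+ {u = λ m → u m Fin.zero} (h Fin.zero) (∼-∑ {u = λ m → u m ∘ Fin.suc} (h ∘ Fin.suc))

-- As all entries have the same degree `d`, all terms of the Laplace expansion have the same degree,
-- and the leading coefficients form the same determinant.
∼-det : ∀ {n} {M : ℕ → Fin n → Fin n → ℤ} {L : Fin n → Fin n → ℤ} {d} →
  (∀ i j → (λ m → M m i j) ∼ L i j [1+m]^ d) → (λ m → det (M m)) ∼ det L [1+m]^ (n ℕ.* d)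
∼-det {zero}  h = ∼-const (+ 1)
∼-det {suc n} {M} {L} h = ∼-∑ {u = λ m → laplace-term (M m)} {L = laplace-term L} λ j →
  ∼-* {u = λ _ → sgn (Fin.toℕ j)} (∼-const (sgn (Fin.toℕ j)))
    (∼-* {u = λ m → M m Fin.zero j} {v = λ m → cofactor (M m) j} (h Fin.zero j)
      (∼-det {M = λ m i k → M m (Fin.suc i) (punchIn j k)} λ i k → h (Fin.suc i) (punchIn j k)))

-- For negative `L` and nonnegative `u m` the error is at least (m+1)^d. Taking m = `C`, the
-- constant of the error bound, gives (C+1) P ≤ C P with P > 0, a contradiction.
∼-nonneg : ∀ {u L d} → u ∼ L [1+m]^ d → (∀ m → + 0 ℤ.≤ u m) → + 0 ℤ.≤ L
∼-nonneg {L = + L} _ _ = +≤+ z≤n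
∼-nonneg {u} { -[1+ L ]} {d} (asymptotics C h) u≥0 = ⊥-elim (ℕ.1+n≰n (ℕ.*-cancelʳ-≤ (suc C) C P
  (ℕ.≤-trans (ℕ.*-monoʳ-≤ (suc C) P≤error) (h C))))
  where
  P = suc C ℕ.^ d
  instance
    P≢0 : ℕ.NonZero P
    P≢0 = ℕ.m^n≢0 (suc C) d
  gap : ∀ x → + 0 ℤ.≤ x → P ℕ.≤ ∣ x - -[1+ L ] * + P ∣
  gap (+ x) _ = ℕ.≤-trans (ℕ.m≤n*m P (suc L)) (ℕ.≤-trans (ℕ.m≤n+m _ x) (ℕ.≤-reflexive (cong ∣_∣ (sym value))))
    where
    open +-*-Solver
    value : + x - -[1+ L ] * + P ≡ + (x ℕ.+ suc L ℕ.* P)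
    value = trans (solve 3 (λ x l p → x :- (:- l) :* p := x :+ l :* p) refl (+ x) (+ suc L) (+ P))
      (trans (cong (_+_ (+ x)) (sym (ℤ.pos-* (suc L) P))) (sym (ℤ.pos-+ x (suc L ℕ.* P))))
  P≤error : P ℕ.≤ ∣ u C - -[1+ L ] * + P ∣
  P≤error = gap (u C) (u≥0 C)

∼-rise : ∀ c l → (λ m → + rise (m ℕ.+ c) l) ∼ + 1 [1+m]^ l
∼-rise c zero    = ∼-const (+ 1)
∼-rise c (suc l) = ∼-cong
  (λ m → trans (cong (λ x → + suc x * + rise (m ℕ.+ c) l) (sym (ℕ.+-assoc m c l)))
    (sym (ℤ.pos-* (suc (m ℕ.+ c ℕ.+ l)) (rise (m ℕ.+ c) l))))
  (∼-* (∼-linear (c ℕ.+ l)) (∼-rise c l))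

-- Total positivity of the triangles

inflated-∼ : ∀ {a B N n} k → n ℕ.≤ N →
  (λ m → + inflated a B N m n k) ∼ + B n k [1+m]^ N
inflated-∼ {a} {B} {N} {n} k n≤N = subst₂ (λ L d → (λ m → + inflated a B N m n k) ∼ L [1+m]^ d)
  -- The degrees `n ∸ k` and `N ∸ (n ∸ k)` of the two monic factors add up to `N` for every `k`; for
  -- k > n the first is 0.
  (ℤ.*-identityʳ (+ B n k)) (ℕ.m+[n∸m]≡n (ℕ.≤-trans (ℕ.m∸n≤m n k) n≤N))
  (∼-cong
    (λ m → sym (trans (ℤ.pos-* (B n k) _) (cong (+ B n k *_)
      (ℤ.pos-* (rise (m ℕ.+ ρ ℕ.* 2) (n ℕ.∸ k)) (rise (m ℕ.+ (a ℕ.+ N)) ρ)))))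
    (∼-* (∼-const (+ B n k)) (∼-* (∼-rise (ρ ℕ.* 2) (n ℕ.∸ k)) (∼-rise (a ℕ.+ N) ρ))))
  where ρ = N ℕ.∸ (n ℕ.∸ k)

-- For each `m` the inflated minor is, up to positive row and column factors, a minor of a Hurwitz
-- matrix and so nonnegative. Its leading coefficient in `m` is the minor of `B`.
factorialQuotient-totallyPositive : ∀ {a B} → FactorialQuotient a B →
  TotallyPositive (λ n k → + B n k)
factorialQuotient-totallyPositive {a} {B} B-quotient n r c r↑ c↑ with bounded r
... | N , r≤N = ∼-nonneg (∼-det λ i j → inflated-∼ {a} {B} (c j) (r≤N i)) det-W-nonneg
  where
  W H : ℕ → Fin n → Fin n → ℤ
  W m i j = + inflated a B N m (r i) (c j)
  -- The row indices are doubled because the Toeplitz matrix to be compared occupies the even rows.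
  H m i j = Hurwitz (bessel (m ℕ.+ N ℕ.* 2) a) (r i ℕ.* 2) (c j)
  κ : ℕ → Fin n → ℕ
  -- The last factorial depends on neither row nor column and is absorbed into the column factors.
  κ m j = c j ! ℕ.* (a ℕ.+ c j) ! ℕ.* (m ℕ.+ (a ℕ.+ N)) !
  ρ : Fin n → ℕ
  ρ i = r i ! ℕ.* (a ℕ.+ r i) !
  scaled : ∀ m i j → + κ m j * W m i j ≡ + ρ i * H m i j
  scaled m i j = trans (sym (ℤ.pos-* (κ m j) _))
    (trans (cong +_ (inflated-hurwitz B-quotient N m (c j) (r≤N i))) (ℤ.pos-* (ρ i) _))
  factorials-positive : ∀ x y → + 0 ℤ.< + (x ! ℕ.* y !)
  factorials-positive x y = ℤ.+<+ (ℕ.*-mono-≤ (ℕ.1≤n! x) (ℕ.1≤n! y))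
  det-W-nonneg : ∀ m → + 0 ℤ.≤ det (W m)
  det-W-nonneg m = ℤ.*-cancelˡ-≤-pos (+ 0) (det (W m)) (∏ (+_ ∘ κ m))
    {{ℤ.positive (∏-positive (+_ ∘ κ m) λ j →
      ℤ.+<+ (ℕ.*-mono-≤ (ℕ.*-mono-≤ (ℕ.1≤n! (c j)) (ℕ.1≤n! (a ℕ.+ c j))) (ℕ.1≤n! (m ℕ.+ (a ℕ.+ N)))))}}
    (subst₂ ℤ._≤_ (sym (ℤ.*-zeroʳ (∏ (+_ ∘ κ m)))) (begin
        ∏ (+_ ∘ ρ) * det (H m)               ≡⟨ sym (det-scale-rows (+_ ∘ ρ) (H m)) ⟩
        det (λ i j → + ρ i * H m i j)        ≡⟨ det-cong (λ i j → sym (scaled m i j)) ⟩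
        det (λ i j → + κ m j * W m i j)      ≡⟨ det-scale-columns (+_ ∘ κ m) (W m) ⟩
        ∏ (+_ ∘ κ m) * det (W m)             ∎)
      (*-nonneg
        (ℤ.<⇒≤ (∏-positive (+_ ∘ ρ) λ i → factorials-positive (r i) (a ℕ.+ r i)))
        (Hurwitz-totallyPositive (m ℕ.+ N ℕ.* 2) a n (λ i → r i ℕ.* 2) c
          (λ i j i<j → ℕ.*-monoˡ-< 2 (r↑ i j i<j)) c↑)))
    where open ≡-Reasoning

theorem2p2 : TotallyPositive NarayanaA × TotallyPositive NarayanaB
theorem2p2 = factorialQuotient-totallyPositive NA-factorialQuotient
           , factorialQuotient-totallyPositive NB-factorialQuotient
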